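{- Let $n\ge 0$ be an integer. Every odd positive factor $f$ of $GF(3,n)=3^{2^n}+1$ has one of the following two forms: (i) $f=k2^{n+1}+1$ for some odd positive integer $k$ with $3\nmid k$; or (ii) $f=3m2^{n+2}+1$ for some integer $m\ge 0$ (not necessarily odd).
   Context: For an integer $z\ge 0$, $GF(3,z)=3^{2^z}+1$. -}

module Defs where

open import Data.Nat.Base using (ℕ; _+_; _^_)
open import Data.Nat.Divisibility using (_∣_)
open import Relation.Nullary.Negation using (¬_)

GF : ℕ → ℕ → ℕ
GF a z = a ^ (2 ^ z) + 1

Odd : ℕ → Set
Odd n = ¬ (2 ∣ n)

{-# OPTIONS --safe #-}
module Submission where

-- Modulo an odd factor f of 3^N + 1 with N = 2ⁿ, multiplication by 3 acts freely on the nonzero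
-- residues with orbits of size 2N: some multiple of any exponent 0 < e < 2N is congruent to N
-- modulo 2N, and 3^N acts as negation, which has no nonzero fixed point. So f − 1 = k·2N with k
-- the number of orbits. The parity of k comes from a Gauss-lemma count that needs no primality:
-- walking from x to −x along half an orbit changes the parity of the representative (as f is odd),
-- hence meets an odd number of odd quotients ⌊3y/f⌋, and the other half contributes equally. So
-- the number of y with f < 3y < 2f is ≡ 2k modulo 4. Evaluated for f = 3t + 1 (t such y) and
-- f = 3t + 2 (t + 1 such y), when n ≥ 1, this gives k even and divisible by 3, respectively
-- k odd and prime to 3.

open import Defs
open import Data.Nat.Base
open import Data.Nat.Properties
open import Data.Nat.DivMod
open import Data.Nat.Divisibility
open import Data.Nat.ListAction using (sum)
open import Data.Nat.ListAction.Properties using (sum-++; sum-↭)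
open import Data.Nat.Tactic.RingSolver using (solve-∀)
open import Data.List.Base using (List; []; _∷_; _++_; map; concatMap; length; applyUpTo)
open import Data.List.Properties using (length-++; map-++; length-applyUpTo; map-applyUpTo)
open import Data.List.Membership.Propositional using (_∈_)
open import Data.List.Membership.Propositional.Properties
  using (∈-∃++; ∈-++⁺ʳ; ∈-++⁻; ∈-applyUpTo⁺; ∈-applyUpTo⁻)
open import Data.List.Relation.Unary.All as All using (All; []; _∷_)
open import Data.List.Relation.Unary.AllPairs using ([]; _∷_)
open import Data.List.Relation.Unary.Any using (here; there)
import Data.List.Relation.Unary.All.Properties as All
open import Data.List.Relation.Unary.Unique.Propositional using (Unique)
open import Data.List.Relation.Unary.Unique.Propositional.Properties using (applyUpTo⁺₁)
open import Data.List.Relation.Binary.Permutation.Propositional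
  using (_↭_; prep; ↭-refl; ↭-sym; ↭-trans; ↭⇒↭ₛ)
open import Data.List.Relation.Binary.Permutation.Propositional.Properties
  using (∈-resp-↭; All-resp-↭; ↭-length; shift; ++⁺ˡ) renaming (map⁺ to ↭-map⁺)
import Data.List.Relation.Binary.Permutation.Setoid.Properties as ↭ₛ
open import Data.Product.Base using (_×_; ∃-syntax; _,_; proj₁; proj₂)
open import Data.Sum.Base using (_⊎_; inj₁; inj₂)
open import Data.Empty using (⊥)
open import Function.Base using (_∘_)
open import Relation.Nullary using (contradiction)
open import Relation.Binary.PropositionalEquality
  using (_≡_; _≢_; refl; sym; trans; cong; cong₂; subst; setoid; module ≡-Reasoning)

-- Duplicate-free lists and their partition into equivalence classes.

Unique-resp-↭ : ∀ {A : Set} {xs ys : List A} → xs ↭ ys → Unique xs → Unique ys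
Unique-resp-↭ {A} p = ↭ₛ.Unique-resp-↭ (setoid A) (↭⇒↭ₛ p)

Unique-++⇒disjoint : ∀ {A : Set} (xs : List A) {ys z} → Unique (xs ++ ys) →
                     z ∈ xs → z ∈ ys → ⊥
Unique-++⇒disjoint (x ∷ xs) (x≢ ∷ u) (here refl) z∈ys =
  All.lookup x≢ (∈-++⁺ʳ xs z∈ys) refl
Unique-++⇒disjoint (x ∷ xs) (x≢ ∷ u) (there z∈xs) z∈ys =
  Unique-++⇒disjoint xs u z∈xs z∈ys

Unique-++⁻ʳ : ∀ {A : Set} (xs : List A) {ys} → Unique (xs ++ ys) → Unique ys
Unique-++⁻ʳ []       u       = u
Unique-++⁻ʳ (x ∷ xs) (_ ∷ u) = Unique-++⁻ʳ xs u

∈-∷⇒∈ : ∀ {A : Set} {x z : A} {xs} → x ≢ z → z ∈ x ∷ xs → z ∈ xs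
∈-∷⇒∈ x≢z (here refl)  = contradiction refl x≢z
∈-∷⇒∈ x≢z (there z∈xs) = z∈xs

-- The entries of `xs` are cut out of `ys` one at a time; as `xs` has no repetitions, a cut never
-- removes an entry that is still to be found.
subset⇒complement : ∀ {A : Set} (xs ys : List A) → Unique xs →
                    (∀ {z} → z ∈ xs → z ∈ ys) → ∃[ zs ] ys ↭ xs ++ zs
subset⇒complement []       ys _ _ = ys , ↭-refl
subset⇒complement (x ∷ xs) ys (x≢ ∷ u) xs⊆ys
  with as , bs , refl ← ∈-∃++ (xs⊆ys (here refl))
  with zs , p ← subset⇒complement xs (as ++ bs) u
         (λ z∈xs → ∈-∷⇒∈ (All.lookup x≢ z∈xs) (∈-resp-↭ (shift x as bs) (xs⊆ys (there z∈xs))))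
  = zs , ↭-trans (shift x as bs) (prep x p)

module _ {A : Set} (P : A → Set) (cls : A → List A)
  (cls-unique : ∀ {x} → P x → Unique (cls x))
  (cls-refl   : ∀ {x} → P x → x ∈ cls x)
  (cls-sym    : ∀ {x y} → P x → y ∈ cls x → x ∈ cls y)
  (cls-trans  : ∀ {x y z} → P x → y ∈ cls x → z ∈ cls y → z ∈ cls x)
  where

  -- The class of the head is split off and the remainder `zs` is treated in the same way. It is
  -- still closed under `cls`, because a class that meets `cls x` lies within it.
  class-partition : ∀ xs → Unique xs → All P xs → (∀ {x y} → x ∈ xs → y ∈ cls x → y ∈ xs) →
                    ∃[ rs ] All P rs × xs ↭ concatMap cls rs
  class-partition xs = go (length xs) xs ≤-refl
    where
    -- The bound `b` on the length drives the recursion, since `zs` is not a structural sublist of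
    -- `xs`. It decreases because a class contains its own representative.
    go : ∀ b xs → length xs ≤ b → Unique xs → All P xs →
         (∀ {x y} → x ∈ xs → y ∈ cls x → y ∈ xs) →
         ∃[ rs ] All P rs × xs ↭ concatMap cls rs
    go b []         _  _ _ _ = [] , [] , ↭-refl
    go (suc b) (x ∷ xs) len≤ u (px ∷ pxs) closed
      with zs , p ← subset⇒complement (cls x) (x ∷ xs) (cls-unique px) (closed (here refl))
      = x ∷ proj₁ rec , px ∷ proj₁ (proj₂ rec) , ↭-trans p (++⁺ˡ (cls x) (proj₂ (proj₂ rec)))
      where
      u′ : Unique (cls x ++ zs)
      u′ = Unique-resp-↭ p u
      pzs : All P zs
      pzs = All.++⁻ʳ (cls x) (All-resp-↭ p (px ∷ pxs))
      closed′ : ∀ {y z} → y ∈ zs → z ∈ cls y → z ∈ zs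
      closed′ {y} y∈zs z∈y
        with ∈-++⁻ (cls x) (∈-resp-↭ p (closed (∈-resp-↭ (↭-sym p) (∈-++⁺ʳ (cls x) y∈zs)) z∈y))
      ... | inj₂ z∈zs = z∈zs
      -- If `z` were in the class of `x`, then by symmetry and transitivity so would `y`, which lies
      -- in `zs`, disjoint from that class.
      ... | inj₁ z∈x  = contradiction y∈zs
        (Unique-++⇒disjoint (cls x) u′ (cls-trans px z∈x (cls-sym (All.lookup pzs y∈zs) z∈y)))
      0<|cls| : ∀ {ys : List A} → x ∈ ys → 0 < length ys
      0<|cls| (here _)  = z<s
      0<|cls| (there _) = z<s
      |zs|≤b : length zs ≤ b
      |zs|≤b = s≤s⁻¹ (begin
        suc (length zs)              ≤⟨ +-monoˡ-≤ (length zs) (0<|cls| (cls-refl px)) ⟩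
        length (cls x) + length zs   ≡⟨ sym (length-++ (cls x)) ⟩
        length (cls x ++ zs)         ≡⟨ sym (↭-length p) ⟩
        length (x ∷ xs)              ≤⟨ len≤ ⟩
        suc b                        ∎)
        where open ≤-Reasoning
      rec : ∃[ rs ] All P rs × zs ↭ concatMap cls rs
      rec = go b zs |zs|≤b (Unique-++⁻ʳ (cls x) u′) pzs closed′

-- Lengths and sums of concatenated and tabulated lists.

length-concatMap : ∀ {A B : Set} (g : A → List B) {m} xs → All (λ x → length (g x) ≡ m) xs →
                   length (concatMap g xs) ≡ length xs * m
length-concatMap g []       []         = refl
length-concatMap g (x ∷ xs) (eq ∷ eqs) =
  trans (length-++ (g x)) (cong₂ _+_ eq (length-concatMap g xs eqs))

-- With every class contributing 2 modulo 4, the total weight reveals the parity of the number of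
-- classes.
sum-concatMap-mod4 : ∀ {A B : Set} (w : B → ℕ) (g : A → List B) xs →
  All (λ x → ∃[ u ] sum (map w (g x)) ≡ 2 + 4 * u) xs →
  ∃[ u ] sum (map w (concatMap g xs)) ≡ 2 * length xs + 4 * u
sum-concatMap-mod4 w g []       []               = 0 , refl
sum-concatMap-mod4 w g (x ∷ xs) ((u , eq) ∷ eqs)
  with v , eq′ ← sum-concatMap-mod4 w g xs eqs
  = u + v , (begin
  sum (map w (g x ++ concatMap g xs))                    ≡⟨ cong sum (map-++ w (g x) _) ⟩
  sum (map w (g x) ++ map w (concatMap g xs))            ≡⟨ sum-++ (map w (g x)) _ ⟩
  sum (map w (g x)) + sum (map w (concatMap g xs))       ≡⟨ cong₂ _+_ eq eq′ ⟩
  2 + 4 * u + (2 * length xs + 4 * v)                    ≡⟨ regroup (length xs) u v ⟩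
  2 * suc (length xs) + 4 * (u + v)                      ∎)
  where
  open ≡-Reasoning
  regroup : ∀ l u v → 2 + 4 * u + (2 * l + 4 * v) ≡ 2 * (1 + l) + 4 * (u + v)
  regroup = solve-∀

sum-applyUpTo-+ : ∀ (h : ℕ → ℕ) m n →
  sum (applyUpTo h (m + n)) ≡ sum (applyUpTo h m) + sum (applyUpTo (h ∘ (m +_)) n)
sum-applyUpTo-+ h zero    n = refl
sum-applyUpTo-+ h (suc m) n =
  trans (cong (h 0 +_) (sum-applyUpTo-+ (h ∘ suc) m n)) (sym (+-assoc (h 0) _ _))

sum-applyUpTo-cong : ∀ {g h : ℕ → ℕ} n → (∀ {i} → i < n → g i ≡ h i) →
                     sum (applyUpTo g n) ≡ sum (applyUpTo h n)
sum-applyUpTo-cong zero    eq = refl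
sum-applyUpTo-cong (suc n) eq = cong₂ _+_ (eq z<s) (sum-applyUpTo-cong n (eq ∘ s<s))

sum-applyUpTo-const : ∀ c n → sum (applyUpTo (λ _ → c) n) ≡ n * c
sum-applyUpTo-const c zero    = refl
sum-applyUpTo-const c (suc n) = cong (c +_) (sum-applyUpTo-const c n)

-- Parity, powers of 2, and divisibility.

even-or-odd : ∀ n → ∃[ h ] (n ≡ 2 * h ⊎ n ≡ 1 + 2 * h)
even-or-odd zero    = 0 , inj₁ refl
even-or-odd (suc n) with even-or-odd n
... | h , inj₁ refl = h , inj₂ refl
... | h , inj₂ refl = suc h , inj₁ (sym (*-suc 2 h))

odd⇒1+2* : ∀ {n} → Odd n → ∃[ h ] n ≡ 1 + 2 * h
odd⇒1+2* {n} odd with even-or-odd n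
... | h , inj₁ refl = contradiction (m∣m*n h) odd
... | h , inj₂ eq   = h , eq

-- If 0 < e < 2ⁿ⁺¹ then the 2-adic valuation of e is at most n.
odd-multiple-of-2^ : ∀ n e → 0 < e → e < 2 ^ suc n →
                     ∃[ c ] ∃[ o ] c * e ≡ 2 ^ n + o * (2 ^ n + 2 ^ n)
odd-multiple-of-2^ n e 0<e e< with even-or-odd e
-- For odd `e` the multiplier 2ⁿ itself works; an even `e` is halved together with the bound.
odd-multiple-of-2^ n e 0<e e< | h , inj₂ refl = 2 ^ n , h , regroup (2 ^ n) h
  where
  regroup : ∀ N h → N * (1 + 2 * h) ≡ N + h * (N + N)
  regroup = solve-∀
odd-multiple-of-2^ zero    e 0<e e< | zero  , inj₁ refl = contradiction 0<e λ ()
odd-multiple-of-2^ zero    e 0<e e< | suc h , inj₁ refl =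
  contradiction (≤-trans (s≤s (*-monoʳ-≤ 2 {1} {suc h} (s≤s z≤n))) e<) λ { (s≤s (s≤s ())) }
odd-multiple-of-2^ (suc n) e 0<e e< | h , inj₁ refl
  with c , o , eq ← odd-multiple-of-2^ n h (*-cancelˡ-< 2 0 h 0<e) (*-cancelˡ-< 2 h _ e<)
  = c , o , (begin
  c * (2 * h)                                   ≡⟨ left c h ⟩
  2 * (c * h)                                   ≡⟨ cong (2 *_) eq ⟩
  2 * (2 ^ n + o * (2 ^ n + 2 ^ n))             ≡⟨ right (2 ^ n) o ⟩
  2 ^ suc n + o * (2 ^ suc n + 2 ^ suc n)       ∎)
  where
  open ≡-Reasoning
  left : ∀ c h → c * (2 * h) ≡ 2 * (c * h)
  left = solve-∀
  right : ∀ N o → 2 * (N + o * (N + N)) ≡ 2 * N + o * (2 * N + 2 * N)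
  right = solve-∀

n∣m∧m<2n⇒m≡n : ∀ {m n} → n ∣ m → 0 < m → m < n + n → m ≡ n
n∣m∧m<2n⇒m≡n {n = n} (divides zero refl)          0<m m< = contradiction 0<m λ ()
n∣m∧m<2n⇒m≡n {n = n} (divides (suc zero) refl)    0<m m< = +-identityʳ n
n∣m∧m<2n⇒m≡n {n = n} (divides (suc (suc q)) refl) 0<m m< =
  contradiction m< (≤⇒≯ (+-monoʳ-≤ n (m≤m+n n (q * n))))

-- Since 2 is its own inverse modulo 3, a factor 2 is removed by doubling once more: 2(2m) = 3m + m.
3∣m*2^n⇒3∣m : ∀ m n → 3 ∣ m * 2 ^ n → 3 ∣ m
3∣m*2^n⇒3∣m m zero    3∣ = subst (3 ∣_) (*-identityʳ m) 3∣
3∣m*2^n⇒3∣m m (suc n) 3∣ = ∣m+n∣m⇒∣n {m = 3 * m} {n = m}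
  (subst (3 ∣_) (regroup m) (∣n⇒∣m*n 2 (3∣m*2^n⇒3∣m (m * 2) n
    (subst (3 ∣_) (sym (*-assoc m 2 (2 ^ n))) 3∣))))
  (m∣m*n m)
  where
  regroup : ∀ m → 2 * (m * 2) ≡ 3 * m + m
  regroup = solve-∀

quotient-unique : ∀ {m r} q d .{{_ : NonZero d}} → m ≡ r + q * d → r < d → m / d ≡ q
quotient-unique {r = r} q d refl r<d = begin
  (r + q * d) / d      ≡⟨ +-distrib-/-∣ʳ r (n∣m*n q) ⟩
  r / d + q * d / d    ≡⟨ cong₂ _+_ (m<n⇒m/n≡0 r<d) (m*n/n≡m q d) ⟩
  q                    ∎
  where open ≡-Reasoning

-- For odd f and 0 < x < f, taking the even residues as half-system, carry f x is 1 exactly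
-- when tripling x modulo f changes the half.
carry : (f : ℕ) .{{_ : NonZero f}} → ℕ → ℕ
carry f x = 3 * x / f % 2

-- Multiplication by powers of 3 on the nonzero residues modulo `f`.

module Tripling (n f : ℕ) .{{_ : NonZero f}} (f-odd : Odd f) (f∣GF : f ∣ GF 3 n) where

  N M : ℕ
  N = 2 ^ n
  M = N + N

  instance
    M-nonZero : NonZero M
    M-nonZero = >-nonZero (≤-trans (m^n>0 2 n) (m≤m+n N N))

  w : ℕ → ℕ
  w = carry f

  act : ℕ → ℕ → ℕ
  act i x = 3 ^ i * x % f

  Residue : ℕ → Set
  Residue x = 0 < x × x < f

  act-+ : ∀ i j x → act i (act j x) ≡ act (i + j) x
  act-+ i j x = begin
    3 ^ i * (3 ^ j * x % f) % f                    ≡⟨ %-distribˡ-* (3 ^ i) (3 ^ j * x % f) f ⟩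
    (3 ^ i % f) * (3 ^ j * x % f % f) % f          ≡⟨ cong (λ y → (3 ^ i % f) * y % f) (m%n%n≡m%n (3 ^ j * x) f) ⟩
    (3 ^ i % f) * (3 ^ j * x % f) % f              ≡⟨ sym (%-distribˡ-* (3 ^ i) (3 ^ j * x) f) ⟩
    3 ^ i * (3 ^ j * x) % f                        ≡⟨ cong (_% f) (sym (*-assoc (3 ^ i) (3 ^ j) x)) ⟩
    3 ^ i * 3 ^ j * x % f                          ≡⟨ cong (λ y → y * x % f) (sym (^-distribˡ-+-* 3 i j)) ⟩
    3 ^ (i + j) * x % f                            ∎
    where open ≡-Reasoning

  act-0 : ∀ {x} → Residue x → act 0 x ≡ x
  act-0 {x} (_ , x<f) = trans (cong (_% f) (*-identityˡ x)) (m<n⇒m%n≡m x<f)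

  -- As `f` divides (3^N + 1)x, it divides the sum of the two residues, which lies strictly between
  -- 0 and 2f.
  act-N : ∀ {x} → Residue x → act N x + x ≡ f
  act-N {x} (0<x , x<f) = n∣m∧m<2n⇒m≡n f∣ (<-≤-trans 0<x (m≤n+m x (act N x)))
    (+-mono-< (m%n<n (3 ^ N * x) f) x<f)
    where
    z = 3 ^ N * x
    f∣ : f ∣ z % f + x
    f∣ = ∣m+n∣m⇒∣n (subst (f ∣_) eq (∣m⇒∣m*n x f∣GF)) (n∣m*n (z / f))
      where
      open ≡-Reasoning
      expand : ∀ a x → (a + 1) * x ≡ a * x + x
      expand = solve-∀
      regroup : ∀ r q x → r + q + x ≡ q + (r + x)
      regroup = solve-∀
      eq : (3 ^ N + 1) * x ≡ z / f * f + (z % f + x)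
      eq = begin
        (3 ^ N + 1) * x               ≡⟨ expand (3 ^ N) x ⟩
        z + x                         ≡⟨ cong (_+ x) (m≡m%n+[m/n]*n z f) ⟩
        z % f + z / f * f + x         ≡⟨ regroup (z % f) (z / f * f) x ⟩
        z / f * f + (z % f + x)       ∎

  act-N-residue : ∀ {x} → Residue x → Residue (act N x)
  act-N-residue {x} px@(_ , x<f) =
    n≢0⇒n>0 (λ eq → <-irrefl (trans (cong (_+ x) (sym eq)) (act-N px)) x<f) ,
    m%n<n (3 ^ N * x) f

  -- `act M` is negation applied twice.
  act-M : ∀ {x} → Residue x → act M x ≡ x
  act-M {x} px = trans (sym (act-+ N N x))
    (+-cancelʳ-≡ (act N x) _ _
      (trans (act-N (act-N-residue px)) (trans (sym (act-N px)) (+-comm (act N x) x))))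

  act-multiple : ∀ {x} e c → Residue x → act e x ≡ x → act (c * e) x ≡ x
  act-multiple e zero    px eq = act-0 px
  act-multiple {x} e (suc c) px eq =
    trans (sym (act-+ e (c * e) x)) (trans (cong (act e) (act-multiple e c px eq)) eq)

  abstract
    -- The exponent i(M - 1) completes `i` to a multiple of the period `M`.
    act-inverse : ∀ i → ∃[ j ] (∀ {x} → Residue x → act j (act i x) ≡ x)
    act-inverse i = i * pred M , λ {x} px → (begin
      act (i * pred M) (act i x)   ≡⟨ act-+ (i * pred M) i x ⟩
      act (i * pred M + i) x       ≡⟨ cong (λ e → act e x) (+-comm _ i) ⟩
      act (i + i * pred M) x       ≡⟨ cong (λ e → act e x) (sym (*-suc i (pred M))) ⟩
      act (i * suc (pred M)) x     ≡⟨ cong (λ e → act (i * e) x) (suc-pred M) ⟩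
      act (i * M) x                ≡⟨ act-multiple M i px (act-M px) ⟩
      x                            ∎)
      where
      open ≡-Reasoning

  -- If `act i x` were 0, undoing it would send 0 to `x`, although every `act j` fixes 0.
  -- Invertibility thus stands in for the coprimality of 3 and `f`.
  act-residue : ∀ i {x} → Residue x → Residue (act i x)
  act-residue i {x} px@(0<x , _) with j , inv ← act-inverse i =
    n≢0⇒n>0 (λ eq → contradiction
      (trans (sym (inv px)) (trans (cong (act j) eq) (n∣m⇒m%n≡0 _ f (∣n⇒∣m*n (3 ^ j) (f ∣0)))))
      (m<n⇒n≢0 0<x)) ,
    m%n<n (3 ^ i * x) f

  -- A multiple of e is congruent to N modulo M, and act N is negation.
  act-free : ∀ {x} e → Residue x → 0 < e → e < M → act e x ≢ x
  act-free {x} e px 0<e e<M eq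
    with c , o , ce≡ ← odd-multiple-of-2^ n e 0<e
                         (subst (e <_) (cong (N +_) (sym (+-identityʳ N))) e<M)
    = f-odd (subst (2 ∣_) x+x≡f (m∣m*n x))
    where
    open ≡-Reasoning
    act-N≡ : act N x ≡ x
    act-N≡ = begin
      act N x                   ≡⟨ cong (act N) (sym (act-multiple M o px (act-M px))) ⟩
      act N (act (o * M) x)     ≡⟨ act-+ N (o * M) x ⟩
      act (N + o * M) x         ≡⟨ cong (λ i → act i x) (sym ce≡) ⟩
      act (c * e) x             ≡⟨ act-multiple e c px eq ⟩
      x                         ∎
    x+x≡f : 2 * x ≡ f
    x+x≡f = begin
      x + (x + 0)      ≡⟨ cong (x +_) (+-identityʳ x) ⟩
      x + x            ≡⟨ cong (_+ x) (sym act-N≡) ⟩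
      act N x + x      ≡⟨ act-N px ⟩
      f                ∎

  -- Orbits of tripling and the partition of the residues into them.

  orbit : ℕ → List ℕ
  orbit x = applyUpTo (λ i → act i x) M

  -- The orbit lists only exponents below `M`; by periodicity any exponent may be replaced by its
  -- remainder modulo `M`.
  act∈orbit : ∀ i {x} → Residue x → act i x ∈ orbit x
  act∈orbit i {x} px = subst (_∈ orbit x) (begin
    act (i % M) x                         ≡⟨ cong (act (i % M)) (sym (act-multiple M (i / M) px (act-M px))) ⟩
    act (i % M) (act (i / M * M) x)       ≡⟨ act-+ (i % M) (i / M * M) x ⟩
    act (i % M + i / M * M) x             ≡⟨ cong (λ e → act e x) (sym (m≡m%n+[m/n]*n i M)) ⟩
    act i x                               ∎)
    (∈-applyUpTo⁺ (λ i → act i x) (m%n<n i M))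
    where open ≡-Reasoning

  orbit⇒act : ∀ {x y} → y ∈ orbit x → ∃[ i ] y ≡ act i x
  orbit⇒act {x} y∈ with i , _ , eq ← ∈-applyUpTo⁻ (λ i → act i x) y∈ = i , eq

  orbit-refl : ∀ {x} → Residue x → x ∈ orbit x
  orbit-refl {x} px = subst (_∈ orbit x) (act-0 px) (act∈orbit 0 px)

  orbit-sym : ∀ {x y} → Residue x → y ∈ orbit x → x ∈ orbit y
  orbit-sym {x} px y∈ with i , refl ← orbit⇒act y∈ with j , inv ← act-inverse i =
    subst (_∈ orbit (act i x)) (inv px) (act∈orbit j (act-residue i px))

  orbit-trans : ∀ {x y z} → Residue x → y ∈ orbit x → z ∈ orbit y → z ∈ orbit x
  orbit-trans {x} px y∈ z∈ with i , refl ← orbit⇒act y∈ with j , refl ← orbit⇒act z∈ =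
    subst (_∈ orbit x) (sym (act-+ j i x)) (act∈orbit (j + i) px)

  -- A coincidence at exponents i < j would make `act (j ∸ i)` fix the residue `act i x`, against
  -- `act-free`.
  orbit-unique : ∀ {x} → Residue x → Unique (orbit x)
  orbit-unique {x} px = applyUpTo⁺₁ (λ i → act i x) M λ {i} {j} i<j j<M eq →
    act-free (j ∸ i) (act-residue i px) (m<n⇒0<n∸m i<j) (≤-<-trans (m∸n≤m j i) j<M)
      (trans (act-+ (j ∸ i) i x) (trans (cong (λ e → act e x) (m∸n+n≡m (<⇒≤ i<j))) (sym eq)))

  residues : List ℕ
  residues = applyUpTo suc (pred f)

  ∈residues⇒Residue : ∀ {x} → x ∈ residues → Residue x
  ∈residues⇒Residue x∈ with i , i<f-1 , refl ← ∈-applyUpTo⁻ suc x∈ = z<s , m≤pred[n]⇒suc[m]≤n i<f-1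

  Residue⇒∈residues : ∀ {x} → Residue x → x ∈ residues
  Residue⇒∈residues {suc x} (_ , x<f) = ∈-applyUpTo⁺ suc (suc[m]≤n⇒m≤pred[n] x<f)

  abstract
    residues-partition : ∃[ rs ] All Residue rs × residues ↭ concatMap orbit rs
    residues-partition = class-partition Residue orbit
      orbit-unique orbit-refl orbit-sym orbit-trans residues
      (applyUpTo⁺₁ suc (pred f) λ i<j _ eq → <⇒≢ i<j (suc-injective eq))
      (All.tabulate ∈residues⇒Residue)
      λ x∈ y∈ → closed (∈residues⇒Residue x∈) y∈
      where
      closed : ∀ {x y} → Residue x → y ∈ orbit x → y ∈ residues
      closed px y∈ with i , refl ← orbit⇒act y∈ = Residue⇒∈residues (act-residue i px)

  -- The Gauss-lemma count of carries along an orbit.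

  private
    half : ∃[ h ] f ≡ 1 + 2 * h
    half = odd⇒1+2* f-odd
    h = proj₁ half

  -- 3x = act 1 x + qf with f odd and q ≡ w x modulo 2.
  carry-parity : ∀ x → 2 ∣ x + w x + act 1 x
  carry-parity x = ∣m+n∣m⇒∣n (subst (2 ∣_) eq (m∣m*n (2 * x))) (m∣m*n (h * w x + v * f))
    where
    open ≡-Reasoning
    q = 3 * x / f
    v = q / 2
    r = act 1 x
    regroup : ∀ x r w v h → x + (r + (w + v * 2) * (1 + 2 * h))
                          ≡ 2 * (h * w + v * (1 + 2 * h)) + (x + w + r)
    regroup = solve-∀
    double : ∀ x → 2 * (2 * x) ≡ x + 3 * x
    double = solve-∀
    eq : 2 * (2 * x) ≡ 2 * (h * w x + v * f) + (x + w x + r)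
    eq = begin
      2 * (2 * x)                                         ≡⟨ double x ⟩
      x + 3 * x                                           ≡⟨ cong (x +_) (m≡m%n+[m/n]*n (3 * x) f) ⟩
      x + (r + q * f)                                     ≡⟨ cong (λ y → x + (r + y * f)) (m≡m%n+[m/n]*n q 2) ⟩
      x + (r + (w x + v * 2) * f)                         ≡⟨ cong (λ y → x + (r + (w x + v * 2) * y)) (proj₂ half) ⟩
      x + (r + (w x + v * 2) * (1 + 2 * h))               ≡⟨ regroup x r (w x) v h ⟩
      2 * (h * w x + v * (1 + 2 * h)) + (x + w x + r)     ≡⟨ cong (λ y → 2 * (h * w x + v * y) + (x + w x + r)) (sym (proj₂ half)) ⟩
      2 * (h * w x + v * f) + (x + w x + r)               ∎

  orbitSum : ℕ → ℕ → ℕ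
  orbitSum m x = sum (applyUpTo (λ i → w (act i x)) m)

  -- `carry-parity` telescopes along the walk: every intermediate residue is counted twice, so only
  -- the two ends and the carries remain.
  orbitSum-parity : ∀ m {x} → Residue x → 2 ∣ x + orbitSum m x + act m x
  orbitSum-parity zero    {x} px =
    subst (2 ∣_) (sym (cong (x + 0 +_) (act-0 px))) (subst (2 ∣_) (regroup x) (m∣m*n x))
    where
    regroup : ∀ x → 2 * x ≡ x + 0 + x
    regroup = solve-∀
  orbitSum-parity (suc m) {x} px = ∣m+n∣m⇒∣n (subst (2 ∣_) eq
    (∣m∣n⇒∣m+n (carry-parity x) (orbitSum-parity m (act-residue 1 px)))) (m∣m*n y)
    where
    open ≡-Reasoning
    y = act 1 x
    act-suc : ∀ i → act i y ≡ act (suc i) x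
    act-suc i = trans (act-+ i 1 x) (cong (λ e → act e x) (+-comm i 1))
    regroup : ∀ x w y s z → x + w + y + (y + s + z) ≡ 2 * y + (x + (w + s) + z)
    regroup = solve-∀
    eq : x + w x + y + (y + orbitSum m y + act m y) ≡ 2 * y + (x + orbitSum (suc m) x + act (suc m) x)
    eq = begin
      x + w x + y + (y + orbitSum m y + act m y)
        ≡⟨ regroup x (w x) y (orbitSum m y) (act m y) ⟩
      2 * y + (x + (w x + orbitSum m y) + act m y)
        ≡⟨ cong₂ (λ s z → 2 * y + (x + s + z))
             (cong₂ _+_ (cong w (sym (act-0 px)))
                        (sum-applyUpTo-cong m λ {i} _ → cong w (act-suc i)))
             (act-suc m) ⟩
      2 * y + (x + orbitSum (suc m) x + act (suc m) x) ∎

  abstract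
    -- The ends of half an orbit, `x` and its negative, add up to the odd number `f`; the carries
    -- between them must compensate.
    orbitSum-N-odd : ∀ {x} → Residue x → ∃[ u ] orbitSum N x ≡ 1 + 2 * u
    orbitSum-N-odd {x} px = odd⇒1+2* λ 2∣S → f-odd (∣m+n∣m⇒∣n
      (subst (2 ∣_) (trans (regroup x (orbitSum N x) (act N x)) (cong (orbitSum N x +_) (act-N px)))
        (orbitSum-parity N px)) 2∣S)
      where
      regroup : ∀ x s z → x + s + z ≡ s + (z + x)
      regroup = solve-∀

  -- The quotients of 3x and 3(f − x) by f add up to 2.
  carry-neg : ∀ {x} → Residue x → w (act N x) ≡ w x
  carry-neg {x} px = same-parity q′ q (*-cancelʳ-≡ (q′ + q) 2 f
    (+-cancelˡ-≡ (act 1 y + act 1 x) ((q′ + q) * f) (2 * f) sums))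
    where
    open ≡-Reasoning
    y = act N x
    q′ = 3 * y / f
    q = 3 * x / f
    regroup : ∀ r′ r q′ q f → r′ + r + (q′ + q) * f ≡ (r′ + q′ * f) + (r + q * f)
    regroup = solve-∀
    -- Tripling commutes with negation, so the tripled residues are again opposite.
    remainders : act 1 y + act 1 x ≡ f
    remainders = begin
      act 1 (act N x) + act 1 x      ≡⟨ cong (_+ act 1 x) (act-+ 1 N x) ⟩
      act (1 + N) x + act 1 x        ≡⟨ cong (λ e → act e x + act 1 x) (+-comm 1 N) ⟩
      act (N + 1) x + act 1 x        ≡⟨ cong (_+ act 1 x) (sym (act-+ N 1 x)) ⟩
      act N (act 1 x) + act 1 x      ≡⟨ act-N (act-residue 1 px) ⟩
      f                              ∎
    sums : act 1 y + act 1 x + (q′ + q) * f ≡ act 1 y + act 1 x + 2 * f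
    sums = begin
      act 1 y + act 1 x + (q′ + q) * f              ≡⟨ regroup (act 1 y) (act 1 x) q′ q f ⟩
      (act 1 y + q′ * f) + (act 1 x + q * f)        ≡⟨ cong₂ _+_ (sym (m≡m%n+[m/n]*n (3 * y) f)) (sym (m≡m%n+[m/n]*n (3 * x) f)) ⟩
      3 * y + 3 * x                                 ≡⟨ sym (*-distribˡ-+ 3 y x) ⟩
      3 * (y + x)                                   ≡⟨ cong (3 *_) (act-N px) ⟩
      f + 2 * f                                     ≡⟨ cong (_+ 2 * f) (sym remainders) ⟩
      act 1 y + act 1 x + 2 * f                     ∎
    same-parity : ∀ a b → a + b ≡ 2 → a % 2 ≡ b % 2
    same-parity 0 _ refl = refl
    same-parity 1 _ refl = refl
    same-parity 2 _ refl = refl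

  abstract
    -- The second half of the orbit is the negative of the first, and `carry-neg` gives it the same
    -- carries. The sum is therefore twice an odd number.
    orbit-carry-sum : ∀ {x} → Residue x → ∃[ u ] sum (map w (orbit x)) ≡ 2 + 4 * u
    orbit-carry-sum {x} px with u , eq ← orbitSum-N-odd px = u , (begin
      sum (map w (orbit x))                                       ≡⟨ cong sum (map-applyUpTo (λ i → act i x) w M) ⟩
      orbitSum (N + N) x                                          ≡⟨ sum-applyUpTo-+ (λ i → w (act i x)) N N ⟩
      orbitSum N x + sum (applyUpTo (λ i → w (act (N + i) x)) N)  ≡⟨ cong (orbitSum N x +_) (sum-applyUpTo-cong N λ {i} _ → neg i) ⟩
      orbitSum N x + orbitSum N x                                 ≡⟨ cong₂ _+_ eq eq ⟩
      (1 + 2 * u) + (1 + 2 * u)                                   ≡⟨ regroup u ⟩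
      2 + 4 * u                                                   ∎)
      where
      open ≡-Reasoning
      neg : ∀ i → w (act (N + i) x) ≡ w (act i x)
      neg i = trans (cong w (sym (act-+ N i x))) (carry-neg (act-residue i px))
      regroup : ∀ u → (1 + 2 * u) + (1 + 2 * u) ≡ 2 + 4 * u
      regroup = solve-∀

  -- Here `k` is the number of orbits. Each has `M` elements and carry sum 2 modulo 4, so one
  -- partition yields both equations.
  orbit-count : ∃[ k ] pred f ≡ k * M × ∃[ u ] sum (applyUpTo (w ∘ suc) (pred f)) ≡ 2 * k + 4 * u
  orbit-count with rs , prs , p ← residues-partition
    with u , eq ← sum-concatMap-mod4 w orbit rs (All.map orbit-carry-sum prs)
    = length rs
    , trans (sym (length-applyUpTo suc (pred f))) (trans (↭-length p)
        (length-concatMap orbit rs (All.universal (λ x → length-applyUpTo (λ i → act i x) M) rs)))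
    , u , trans (cong sum (sym (map-applyUpTo suc w (pred f)))) (trans (sum-↭ (↭-map⁺ w p)) eq)

-- Explicit carry counts for f = 3t + 1 and f = 3t + 2.

carry-block : ∀ f .{{_ : NonZero f}} (g : ℕ → ℕ) q m → (∀ {i} → i < m → 3 * g i / f ≡ q) →
              sum (applyUpTo (carry f ∘ g) m) ≡ m * (q % 2)
carry-block f g q m eq =
  trans (sum-applyUpTo-cong m (λ i<m → cong (_% 2) (eq i<m))) (sum-applyUpTo-const (q % 2) m)

-- The carry of x is 1 exactly when f < 3x < 2f, so it is 0, 1, 0 on three consecutive blocks.
carry-count-1 : ∀ t → sum (applyUpTo (carry (1 + 3 * t) ∘ suc) (3 * t)) ≡ t
carry-count-1 t = begin
  sum (applyUpTo h (3 * t))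
    -- The last block has length `t + 0` because `3 * t` unfolds to `t + (t + (t + 0))`.
    ≡⟨ sum-applyUpTo-+ h t (t + (t + 0)) ⟩
  sum (applyUpTo h t) + sum (applyUpTo (h ∘ (t +_)) (t + (t + 0)))
    ≡⟨ cong (sum (applyUpTo h t) +_) (sum-applyUpTo-+ (h ∘ (t +_)) t (t + 0)) ⟩
  sum (applyUpTo h t) + (sum (applyUpTo (h ∘ (t +_)) t) + sum (applyUpTo (h ∘ (t +_) ∘ (t +_)) (t + 0)))
    ≡⟨ cong₂ _+_ (carry-block f suc 0 t low)
         (cong₂ _+_ (carry-block f (suc ∘ (t +_)) 1 t middle)
                    (carry-block f (suc ∘ (t +_) ∘ (t +_)) 2 (t + 0)
                      (λ i< → high (subst (_ <_) (+-identityʳ t) i<)))) ⟩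
  t * 0 + (t * 1 + (t + 0) * 0)
    ≡⟨ collect t ⟩
  t ∎
  where
  open ≡-Reasoning
  f = 1 + 3 * t
  h = carry f ∘ suc
  collect : ∀ t → t * 0 + (t * 1 + (t + 0) * 0) ≡ t
  collect = solve-∀
  3+3i≤3t : ∀ {i} → i < t → 3 * suc i ≤ 3 * t
  3+3i≤3t i<t = *-monoʳ-≤ 3 i<t
  low : ∀ {i} → i < t → 3 * suc i / f ≡ 0
  low i<t = m<n⇒m/n≡0 (s≤s (3+3i≤3t i<t))
  middle : ∀ {i} → i < t → 3 * suc (t + i) / f ≡ 1
  middle {i} i<t = quotient-unique {r = 2 + 3 * i} 1 f (expand t i)
    (≤-trans (≤-trans (≤-reflexive (sym (*-suc 3 i))) (3+3i≤3t i<t)) (n≤1+n _))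
    where
    expand : ∀ t i → 3 * (1 + (t + i)) ≡ 2 + 3 * i + 1 * (1 + 3 * t)
    expand = solve-∀
  high : ∀ {i} → i < t → 3 * suc (t + (t + i)) / f ≡ 2
  high {i} i<t = quotient-unique {r = 1 + 3 * i} 2 f (expand t i)
    (≤-trans (≤-trans (n≤1+n _) (≤-reflexive (sym (*-suc 3 i)))) (≤-trans (3+3i≤3t i<t) (n≤1+n _)))
    where
    expand : ∀ t i → 3 * (1 + (t + (t + i))) ≡ 1 + 3 * i + 2 * (1 + 3 * t)
    expand = solve-∀

-- The quotients are again 0, 1, 2 in turn, now on blocks of lengths t, t + 1 and t; only the middle
-- block contributes.
carry-count-2 : ∀ t → sum (applyUpTo (carry (2 + 3 * t) ∘ suc) (1 + 3 * t)) ≡ 1 + t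
carry-count-2 t = begin
  sum (applyUpTo h (1 + 3 * t))
    ≡⟨ cong (λ m → sum (applyUpTo h m)) (split t) ⟩
  sum (applyUpTo h (t + (suc t + t)))
    ≡⟨ sum-applyUpTo-+ h t (suc t + t) ⟩
  sum (applyUpTo h t) + sum (applyUpTo (h ∘ (t +_)) (suc t + t))
    ≡⟨ cong (sum (applyUpTo h t) +_) (sum-applyUpTo-+ (h ∘ (t +_)) (suc t) t) ⟩
  sum (applyUpTo h t) + (sum (applyUpTo (h ∘ (t +_)) (suc t)) + sum (applyUpTo (h ∘ (t +_) ∘ (suc t +_)) t))
    ≡⟨ cong₂ _+_ (carry-block f suc 0 t low)
         (cong₂ _+_ (carry-block f (suc ∘ (t +_)) 1 (suc t) middle)
                    (carry-block f (suc ∘ (t +_) ∘ (suc t +_)) 2 t high)) ⟩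
  t * 0 + ((1 + t) * 1 + t * 0)
    ≡⟨ collect t ⟩
  1 + t ∎
  where
  open ≡-Reasoning
  f = 2 + 3 * t
  h = carry f ∘ suc
  split : ∀ t → 1 + 3 * t ≡ t + (1 + t + t)
  split = solve-∀
  collect : ∀ t → t * 0 + ((1 + t) * 1 + t * 0) ≡ 1 + t
  collect = solve-∀
  low : ∀ {i} → i < t → 3 * suc i / f ≡ 0
  low i<t = m<n⇒m/n≡0 (s≤s (≤-trans (*-monoʳ-≤ 3 i<t) (n≤1+n _)))
  middle : ∀ {i} → i < suc t → 3 * suc (t + i) / f ≡ 1
  middle {i} (s≤s i≤t) = quotient-unique {r = 1 + 3 * i} 1 f (expand t i)
    (s≤s (s≤s (*-monoʳ-≤ 3 i≤t)))
    where
    expand : ∀ t i → 3 * (1 + (t + i)) ≡ 1 + 3 * i + 1 * (2 + 3 * t)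
    expand = solve-∀
  high : ∀ {i} → i < t → 3 * suc (t + (suc t + i)) / f ≡ 2
  high {i} i<t = quotient-unique {r = 2 + 3 * i} 2 f (expand t i)
    (s≤s (s≤s (*-monoʳ-< 3 i<t)))
    where
    expand : ∀ t i → 3 * (1 + (t + (1 + t + i))) ≡ 2 + 3 * i + 2 * (2 + 3 * t)
    expand = solve-∀

-- Residues modulo 3 and the two forms of a factor.

data Mod3 : ℕ → Set where
  0+3* : ∀ t → Mod3 (3 * t)
  1+3* : ∀ t → Mod3 (1 + 3 * t)
  2+3* : ∀ t → Mod3 (2 + 3 * t)

mod3 : ∀ n → Mod3 n
mod3 zero    = 0+3* 0
mod3 (suc n) with mod3 n
... | 0+3* t = 1+3* t
... | 1+3* t = 2+3* t
... | 2+3* t = subst Mod3 (*-suc 3 t) (0+3* (suc t))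

-- The exponent 2ⁿ is positive, so 3 divides the power and would have to divide 1.
3∤GF3 : ∀ n → 3 ∤ GF 3 n
3∤GF3 n 3∣GF with 2 ^ n in eq
... | zero  = contradiction (m^n>0 2 n) (λ 0<N → <-irrefl (sym eq) 0<N)
... | suc e = contradiction (∣1⇒≡1 (∣m+n∣m⇒∣n 3∣GF (m∣m*n (3 ^ e)))) λ ()

Conclusion : ℕ → ℕ → Set
Conclusion n f =
  (∃[ k ] (0 < k × Odd k × 3 ∤ k × f ≡ k * 2 ^ (n + 1) + 1)) ⊎ (∃[ m ] f ≡ 3 * m * 2 ^ (n + 2) + 1)

-- The exponent `suc n` makes the orbit length a multiple of 4, so 4 divides `t`, and t ≡ 2k modulo
-- 4 forces `k` even. The factor 3 of 3t cannot come from the power of 2, hence it divides k/2.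
conclusion-1 : ∀ n k t → 3 * t ≡ k * (2 ^ suc n + 2 ^ suc n) → (∃[ u ] t ≡ 2 * k + 4 * u) →
               Conclusion (suc n) (1 + 3 * t)
conclusion-1 n k t 3t≡kM (u , t≡) with even-or-odd k
... | j , inj₂ refl = contradiction (∣m+n∣m⇒∣n 4∣4a+2 (m∣m*n (j + u))) λ 4∣2 → contradiction (∣⇒≤ 4∣2) λ { (s≤s (s≤s ())) }
  where
  4∣t : 4 ∣ t
  -- 4 divides both 4t = 3t + t and 3t.
  4∣t = ∣m+n∣m⇒∣n (subst (4 ∣_) (+-comm t (3 * t)) (m∣m*n t))
    (subst (4 ∣_) (sym (trans 3t≡kM (regroup (2 ^ n) k))) (m∣m*n (k * 2 ^ n)))
    where
    regroup : ∀ N k → k * (2 * N + 2 * N) ≡ 4 * (k * N)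
    regroup = solve-∀
  4∣4a+2 : 4 ∣ 4 * (j + u) + 2
  4∣4a+2 = subst (4 ∣_) (trans t≡ (regroup j u)) 4∣t
    where
    regroup : ∀ j u → 2 * (1 + 2 * j) + 4 * u ≡ 4 * (j + u) + 2
    regroup = solve-∀
... | j , inj₁ refl = inj₂ (form-2 3∣j)
  where
  open ≡-Reasoning
  3∣j : 3 ∣ j
  3∣j = 3∣m*2^n⇒3∣m j (suc (suc (suc n))) (subst (3 ∣_) (trans 3t≡kM (regroup j (2 ^ n))) (m∣m*n t))
    where
    regroup : ∀ j N → 2 * j * (2 * N + 2 * N) ≡ j * (2 * (2 * (2 * N)))
    regroup = solve-∀
  form-2 : 3 ∣ j → ∃[ m ] 1 + 3 * t ≡ 3 * m * 2 ^ (suc n + 2) + 1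
  form-2 (divides m j≡) = m , (begin
    1 + 3 * t                                      ≡⟨ cong suc 3t≡kM ⟩
    1 + 2 * j * (2 ^ suc n + 2 ^ suc n)            ≡⟨ cong (λ j → 1 + 2 * j * (2 ^ suc n + 2 ^ suc n)) j≡ ⟩
    1 + 2 * (m * 3) * (2 ^ suc n + 2 ^ suc n)      ≡⟨ regroup m (2 ^ suc n) ⟩
    3 * m * (2 ^ suc n * 4) + 1                    ≡⟨ cong (λ N → 3 * m * N + 1) (sym (^-distribˡ-+-* 2 (suc n) 2)) ⟩
    3 * m * 2 ^ (suc n + 2) + 1                    ∎)
    where
    regroup : ∀ m N → 1 + 2 * (m * 3) * (N + N) ≡ 3 * m * (N * 4) + 1
    regroup = solve-∀

-- A factor 3 of `k` would divide 1 + 3t. Positivity of `k` follows from its oddness, which the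
-- carry count supplies.
conclusion-2 : ∀ n k t → 1 + 3 * t ≡ k * (2 ^ suc n + 2 ^ suc n) → (∃[ u ] 1 + t ≡ 2 * k + 4 * u) →
               Conclusion (suc n) (2 + 3 * t)
conclusion-2 n k t 1+3t≡kM (u , 1+t≡) = inj₁ (k , n≢0⇒n>0 (λ { refl → k-odd (2 ∣0) }) , k-odd , 3∤k , f≡)
  where
  open ≡-Reasoning
  3∤k : 3 ∤ k
  3∤k 3∣k = contradiction (∣1⇒≡1 (∣m+n∣m⇒∣n (subst (3 ∣_) (trans (sym 1+3t≡kM) (+-comm 1 (3 * t))) (∣m⇒∣m*n _ 3∣k)) (m∣m*n t))) λ ()
  -- Otherwise 4 divides both 3(1 + t) and 1 + 3t, which differ by 2.
  k-odd : Odd k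
  k-odd (divides j refl) = contradiction (∣⇒≤ (∣m+n∣m⇒∣n 4∣+2 4∣1+3t)) λ { (s≤s (s≤s ())) }
    where
    4∣1+3t : 4 ∣ 1 + 3 * t
    4∣1+3t = subst (4 ∣_) (sym (trans 1+3t≡kM (regroup (2 ^ n) k))) (m∣m*n (k * 2 ^ n))
      where
      regroup : ∀ N k → k * (2 * N + 2 * N) ≡ 4 * (k * N)
      regroup = solve-∀
    4∣+2 : 4 ∣ 1 + 3 * t + 2
    4∣+2 = subst (4 ∣_) (regroup t) (∣n⇒∣m*n 3 (subst (4 ∣_) (sym (trans 1+t≡ (factor j u))) (m∣m*n (j + u))))
      where
      regroup : ∀ t → 3 * (1 + t) ≡ 1 + 3 * t + 2
      regroup = solve-∀
      factor : ∀ j u → 2 * (j * 2) + 4 * u ≡ 4 * (j + u)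
      factor = solve-∀
  f≡ : 2 + 3 * t ≡ k * 2 ^ (suc n + 1) + 1
  f≡ = begin
    2 + 3 * t                                ≡⟨ cong suc 1+3t≡kM ⟩
    1 + k * (2 ^ suc n + 2 ^ suc n)          ≡⟨ regroup k (2 ^ suc n) ⟩
    k * (2 ^ suc n * 2) + 1                  ≡⟨ cong (λ N → k * N + 1) (sym (^-distribˡ-+-* 2 (suc n) 1)) ⟩
    k * 2 ^ (suc n + 1) + 1                  ∎
    where
    regroup : ∀ k N → 1 + k * (N + N) ≡ k * (N * 2) + 1
    regroup = solve-∀

odd∣4⇒≡1 : ∀ {f} → Odd f → f ∣ 4 → f ≡ 1
odd∣4⇒≡1 {0} odd f∣4 = contradiction (0∣⇒≡0 f∣4) λ ()
odd∣4⇒≡1 {1} odd f∣4 = refl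
odd∣4⇒≡1 {2} odd f∣4 = contradiction (m∣m*n 1) odd
odd∣4⇒≡1 {3} odd f∣4 = contradiction (∣1⇒≡1 (∣m+n∣m⇒∣n {m = 3} {n = 1} f∣4 ∣-refl)) λ ()
odd∣4⇒≡1 {4} odd f∣4 = contradiction (m∣m*n 2) odd
odd∣4⇒≡1 {suc (suc (suc (suc (suc f))))} odd f∣4 =
  contradiction (∣⇒≤ f∣4) λ { (s≤s (s≤s (s≤s (s≤s ())))) }

theorem2 : ∀ (n f : ℕ) → 0 < f → Odd f → f ∣ GF 3 n →
    (∃[ k ] (0 < k × Odd k × 3 ∤ k × f ≡ k * 2 ^ (n + 1) + 1))
      ⊎ (∃[ m ] f ≡ 3 * m * 2 ^ (n + 2) + 1)
-- For n = 0 the orbit length is 2, not a multiple of 4, and the parity argument fails. But the only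
-- odd factor of 4 is 1, which has form (ii) with m = 0.
theorem2 zero    f 0<f odd f∣GF = inj₂ (0 , odd∣4⇒≡1 odd f∣GF)
theorem2 (suc n) f 0<f odd f∣GF with mod3 f
... | 0+3* t = contradiction (∣-trans (m∣m*n t) f∣GF) (3∤GF3 (suc n))
... | 1+3* t with k , f′≡kM , u , sum≡ ← Tripling.orbit-count (suc n) (1 + 3 * t) odd f∣GF =
  conclusion-1 n k t f′≡kM (u , trans (sym (carry-count-1 t)) sum≡)
... | 2+3* t with k , f′≡kM , u , sum≡ ← Tripling.orbit-count (suc n) (2 + 3 * t) odd f∣GF =
  conclusion-2 n k t f′≡kM (u , trans (sym (carry-count-2 t)) sum≡)
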